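{- Let $a$ and $b$ be positive coprime integers and let $h$ be a natural number. Then $$T_3(a,b;h)=T_1(a,b;h)+\frac{2b}{a}\,T_2(a,b;h)-\frac{b^2h(h+1)(2h+1)}{6a^2}.$$
   Context: $\lfloor x\rfloor$ is the floor of $x$ and $\{x\}=x-\lfloor x\rfloor$ its fractional part. For positive coprime integers $a,b$ and a natural number $h$, $$T_1(a,b;h):=\sum_{i=1}^{h}\left\{\frac{ib}{a}\right\}^2,\qquad T_2(a,b;h):=\sum_{i=1}^{h}i\left\lfloor\frac{ib}{a}\right\rfloor,\qquad T_3(a,b;h):=\sum_{i=1}^{h}\left\lfloor\frac{ib}{a}\right\rfloor^2 .$$ -}

module Defs where

open import Data.Nat as ℕ using (ℕ; suc; NonZero)
open import Data.Nat.Properties using (m*n≢0; m^n≢0)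
open import Data.Integer using (ℤ; +_)
open import Data.Rational using (ℚ; _/_; _*_; _-_; floor)
open import Data.Rational.Properties using (+-0-commutativeMonoid)
open import Data.Fin using (toℕ)
open import Algebra.Properties.CommutativeMonoid.Sum +-0-commutativeMonoid using (sum)

fromℤ : ℤ → ℚ
fromℤ z = z / 1

fromℕ : ℕ → ℚ
fromℕ n = fromℤ (+ n)

-- The library's fracPart is ∣ x - truncate x ∣, which differs from
-- x - ⌊ x ⌋ for negative x.
frac : ℚ → ℚ
frac x = x - fromℤ (floor x)

infix 8 _²
_² : ℚ → ℚ
x ² = x * x

-- f 1 + ⋯ + f h; the library's sum ranges over Fin h, i.e. 0, …, h - 1.
∑₁ : ℕ → (ℕ → ℚ) → ℚ
∑₁ h f = sum {h} (λ k → f (suc (toℕ k)))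

syntax ∑₁ h (λ i → e) = ∑[1≤ i ≤ h ] e

module _ (a b : ℕ) .{{_ : NonZero a}} (h : ℕ) where

  T₁ : ℚ
  T₁ = ∑[1≤ i ≤ h ] (frac (+ (i ℕ.* b) / a) ²)

  T₂ : ℚ
  T₂ = ∑[1≤ i ≤ h ] (fromℕ i * fromℤ (floor (+ (i ℕ.* b) / a)))

  T₃ : ℚ
  T₃ = ∑[1≤ i ≤ h ] (fromℤ (floor (+ (i ℕ.* b) / a)) ²)

instance
  6a²≢0 : ∀ {a} .{{_ : NonZero a}} → NonZero (6 ℕ.* a ℕ.^ 2)
  6a²≢0 {a} = m*n≢0 6 (a ℕ.^ 2) {{_}} {{m^n≢0 a 2}}

{-# OPTIONS --safe #-}
-- Squaring ⌊q⌋ = q - {q} gives ⌊q⌋² = {q}² + 2q⌊q⌋ - q²; put q = ib/a and sum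
-- over i, using 1² + ⋯ + h² = h(h+1)(2h+1)/6 for the last term.
module Submission where

open import Defs
open import Data.Nat as ℕ using (ℕ; zero; suc; NonZero)
import Data.Nat.Properties as ℕ
open import Data.Nat.Coprimality using (Coprime)
open import Data.Nat.Tactic.RingSolver using (solve-∀)
open import Data.Integer as ℤ using (+_)
import Data.Integer.Properties as ℤ
open import Data.Rational using (ℚ; _/_; _+_; _*_; _-_; floor; fromℚᵘ; 0ℚ; 1ℚ)
open import Data.Rational.Properties
open import Data.Rational.Solver using (module +-*-Solver)
open import Data.Rational.Unnormalised as ℚᵘ using (mkℚᵘ)
import Data.Rational.Unnormalised.Properties as ℚᵘ
open import Relation.Binary.PropositionalEquality

open +-*-Solver using (solve; _:=_; _:+_; _:*_; _:-_)
open ≡-Reasoning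

-- With β = b/a and f = ⌊iβ⌋, the fractional part is iβ - f, so f² = (iβ - f)² + 2β·(i f) - β² i².
-- The three terms on the right are the increments of T₁, 2β T₂ and β² Σ i², which makes the claim
-- an induction on h: `expansion-step` is the algebra, `sumOfSquares-suc` the recursion of the power
-- sum, `T₃-expansion` the induction. The rest is arithmetic of `_/_`, ending in `twice-/` and
-- `closedForm`, which match the coefficients with the stated fractions.

-- Both sides agree after the injective `toℚᵘ`. Unnormalised fractions have explicit numerators and
-- denominators, which is where rules for `_/_` can be read off.
fromℚᵘ-homo-+ : ∀ x y → fromℚᵘ (x ℚᵘ.+ y) ≡ fromℚᵘ x + fromℚᵘ y
fromℚᵘ-homo-+ x y = toℚᵘ-injective
  (ℚᵘ.≃-trans (toℚᵘ-fromℚᵘ (x ℚᵘ.+ y))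
  (ℚᵘ.≃-trans (ℚᵘ.+-cong (ℚᵘ.≃-sym (toℚᵘ-fromℚᵘ x)) (ℚᵘ.≃-sym (toℚᵘ-fromℚᵘ y)))
              (ℚᵘ.≃-sym (toℚᵘ-homo-+ (fromℚᵘ x) (fromℚᵘ y)))))

fromℚᵘ-homo-* : ∀ x y → fromℚᵘ (x ℚᵘ.* y) ≡ fromℚᵘ x * fromℚᵘ y
fromℚᵘ-homo-* x y = toℚᵘ-injective
  (ℚᵘ.≃-trans (toℚᵘ-fromℚᵘ (x ℚᵘ.* y))
  (ℚᵘ.≃-trans (ℚᵘ.*-cong (ℚᵘ.≃-sym (toℚᵘ-fromℚᵘ x)) (ℚᵘ.≃-sym (toℚᵘ-fromℚᵘ y)))
              (ℚᵘ.≃-sym (toℚᵘ-homo-* (fromℚᵘ x) (fromℚᵘ y)))))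

fromℕ-homo-+ : ∀ m n → fromℕ (m ℕ.+ n) ≡ fromℕ m + fromℕ n
fromℕ-homo-+ m n = trans
  -- The unnormalised sum of m/1 and n/1 has numerator m·1 + n·1.
  (cong₂ (λ k l → fromℕ (k ℕ.+ l)) (sym (ℕ.*-identityʳ m)) (sym (ℕ.*-identityʳ n)))
  (trans (cong₂ (λ i j → fromℤ (i ℤ.+ j)) (ℤ.pos-* m 1) (ℤ.pos-* n 1))
         (fromℚᵘ-homo-+ (mkℚᵘ (+ m) 0) (mkℚᵘ (+ n) 0)))

-- The denominator `e` is a variable tied to `c * d` by an equation, so that shapes such as
-- `6 * a ^ 2` fit, with whatever `NonZero` instance they carry.
*-/-interchange : ∀ m n c d {e} .{{_ : NonZero c}} .{{_ : NonZero d}} .{{e≢0 : NonZero e}} →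
                  e ≡ c ℕ.* d → + (m ℕ.* n) / e ≡ (+ m / c) * (+ n / d)
*-/-interchange m n (suc c) (suc d) {e} refl = trans
  (cong (λ p → p / e) (ℤ.pos-* m n))
  (fromℚᵘ-homo-* (mkℚᵘ (+ m) c) (mkℚᵘ (+ n) d))

-- Here and below, the NonZero instances of closed denominators are explicit:
-- otherwise 6a²≢0 is a candidate, and instance search tries to solve
-- equations such as 1 = 6a² by unfolding.
*-/-assoc : ∀ m n d .{{_ : NonZero d}} → + (m ℕ.* n) / d ≡ fromℕ m * (+ n / d)
*-/-assoc m n d = *-/-interchange m n 1 d {{ℕ.nonZero}} (sym (ℕ.*-identityˡ d))

fromℕ-homo-* : ∀ m n → fromℕ (m ℕ.* n) ≡ fromℕ m * fromℕ n
fromℕ-homo-* m n = *-/-assoc m n 1 {{ℕ.nonZero}}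

-- Factoring out 1/d avoids the denominator d·d of an unnormalised sum.
/-distribʳ-+ : ∀ m n d .{{_ : NonZero d}} → + (m ℕ.+ n) / d ≡ (+ m / d) + (+ n / d)
/-distribʳ-+ m n d = begin
  + (m ℕ.+ n) / d                              ≡⟨ asProduct (m ℕ.+ n) ⟩
  fromℕ (m ℕ.+ n) * (+ 1 / d)                  ≡⟨ cong (_* (+ 1 / d)) (fromℕ-homo-+ m n) ⟩
  (fromℕ m + fromℕ n) * (+ 1 / d)              ≡⟨ *-distribʳ-+ (+ 1 / d) (fromℕ m) (fromℕ n) ⟩
  fromℕ m * (+ 1 / d) + fromℕ n * (+ 1 / d)    ≡⟨ cong₂ _+_ (asProduct m) (asProduct n) ⟨
  (+ m / d) + (+ n / d)                        ∎
  where
  asProduct : ∀ k → + k / d ≡ fromℕ k * (+ 1 / d)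
  asProduct k = trans (cong (λ n → + n / d) (sym (ℕ.*-identityʳ k))) (*-/-assoc k 1 d)

-- A sum over `Fin` unfolds at its first term, while the induction on h needs the last one split
-- off; hence the recursion on the shifted summand.
∑₁-suc : ∀ h f → ∑₁ (suc h) f ≡ ∑₁ h f + f (suc h)
∑₁-suc zero    f = trans (+-identityʳ (f 1)) (sym (+-identityˡ (f 1)))
∑₁-suc (suc h) f = trans
  (cong (_+_ (f 1)) (∑₁-suc h (λ i → f (suc i))))
  (sym (+-assoc (f 1) (∑₁ h (λ i → f (suc i))) (f (suc (suc h)))))

sixfoldSumOfSquares : ℕ → ℕ
sixfoldSumOfSquares h = h ℕ.* (h ℕ.+ 1) ℕ.* (2 ℕ.* h ℕ.+ 1)

sumOfSquares : ℕ → ℚ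
sumOfSquares h = (+ sixfoldSumOfSquares h / 6) {{ℕ.nonZero}}

-- The increment is written with 6 as its last factor, ready to cancel against the denominator.
sixfoldSumOfSquares-suc : ∀ h →
  sixfoldSumOfSquares (suc h) ≡ sixfoldSumOfSquares h ℕ.+ suc h ℕ.* suc h ℕ.* 6
sixfoldSumOfSquares-suc = expanded
  where
  expanded : ∀ h → suc h ℕ.* (suc h ℕ.+ 1) ℕ.* (2 ℕ.* suc h ℕ.+ 1)
                     ≡ h ℕ.* (h ℕ.+ 1) ℕ.* (2 ℕ.* h ℕ.+ 1) ℕ.+ suc h ℕ.* suc h ℕ.* 6
  expanded = solve-∀

sumOfSquares-suc : ∀ h → sumOfSquares (suc h) ≡ sumOfSquares h + fromℕ (suc h) ²
sumOfSquares-suc h = begin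
  sumOfSquares (suc h)
    ≡⟨ cong _/6 (sixfoldSumOfSquares-suc h) ⟩
  (sixfoldSumOfSquares h ℕ.+ suc h ℕ.* suc h ℕ.* 6) /6
    ≡⟨ /-distribʳ-+ (sixfoldSumOfSquares h) (suc h ℕ.* suc h ℕ.* 6) 6 {{ℕ.nonZero}} ⟩
  sumOfSquares h + (suc h ℕ.* suc h ℕ.* 6) /6
    -- 6/6 computes to `1ℚ`.
    ≡⟨ cong (_+_ (sumOfSquares h)) (*-/-assoc (suc h ℕ.* suc h) 6 6 {{ℕ.nonZero}}) ⟩
  sumOfSquares h + fromℕ (suc h ℕ.* suc h) * 1ℚ
    ≡⟨ cong (_+_ (sumOfSquares h)) (*-identityʳ (fromℕ (suc h ℕ.* suc h))) ⟩
  sumOfSquares h + fromℕ (suc h ℕ.* suc h)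
    ≡⟨ cong (_+_ (sumOfSquares h)) (fromℕ-homo-* (suc h) (suc h)) ⟩
  sumOfSquares h + fromℕ (suc h) ² ∎
  where
  infix 8 _/6
  _/6 : ℕ → ℚ
  n /6 = (+ n / 6) {{ℕ.nonZero}}

-- Separating β² from the power sum leaves a single factor that depends on h, the form the induction
-- uses.
closedForm : ∀ a b h .{{_ : NonZero a}} →
  + (b ℕ.^ 2 ℕ.* h ℕ.* (h ℕ.+ 1) ℕ.* (2 ℕ.* h ℕ.+ 1)) / (6 ℕ.* a ℕ.^ 2)
    ≡ (+ b / a) ² * sumOfSquares h
closedForm a b h = begin
  + (b ℕ.^ 2 ℕ.* h ℕ.* (h ℕ.+ 1) ℕ.* (2 ℕ.* h ℕ.+ 1)) / (6 ℕ.* a ℕ.^ 2)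
    ≡⟨ cong (λ n → + n / (6 ℕ.* a ℕ.^ 2)) (numerator b h) ⟩
  + (b ℕ.* b ℕ.* sixfoldSumOfSquares h) / (6 ℕ.* a ℕ.^ 2)
    ≡⟨ *-/-interchange (b ℕ.* b) (sixfoldSumOfSquares h) (a ℕ.^ 2) 6
         {{ℕ.m^n≢0 a 2}} {{ℕ.nonZero}} (ℕ.*-comm 6 (a ℕ.^ 2)) ⟩
  (+ (b ℕ.* b) / (a ℕ.^ 2)) {{ℕ.m^n≢0 a 2}} * sumOfSquares h
    ≡⟨ cong (_* sumOfSquares h)
         (*-/-interchange b b a a {{e≢0 = ℕ.m^n≢0 a 2}}
           (cong (a ℕ.*_) (ℕ.*-identityʳ a))) ⟩
  (+ b / a) ² * sumOfSquares h ∎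
  where
  -- `b * (b * 1)` is what `b ^ 2` computes to.
  numerator : ∀ b h → b ℕ.* (b ℕ.* 1) ℕ.* h ℕ.* (h ℕ.+ 1) ℕ.* (2 ℕ.* h ℕ.+ 1)
                        ≡ b ℕ.* b ℕ.* (h ℕ.* (h ℕ.+ 1) ℕ.* (2 ℕ.* h ℕ.+ 1))
  numerator = solve-∀

twice-/ : ∀ b a .{{_ : NonZero a}} → + (2 ℕ.* b) / a ≡ (+ b / a) + (+ b / a)
twice-/ b a = trans
  (cong (λ n → + (b ℕ.+ n) / a) (ℕ.+-identityʳ b))
  (/-distribʳ-+ b b a)

expansion-zero : ∀ β → 0ℚ ≡ 0ℚ + (β + β) * 0ℚ - β ² * 0ℚ
expansion-zero β = sym (cong₂ (λ x y → 0ℚ + x - y) (*-zeroʳ (β + β)) (*-zeroʳ (β ²)))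

expansion-step : ∀ t₁ t₂ s β i f →
  t₁ + (β + β) * t₂ - β ² * s + f ²
    ≡ t₁ + (i * β - f) ² + (β + β) * (t₂ + i * f) - β ² * (s + i ²)
expansion-step = solve 6 (λ t₁ t₂ s β i f →
  t₁ :+ (β :+ β) :* t₂ :- β :* β :* s :+ f :* f
    := t₁ :+ (i :* β :- f) :* (i :* β :- f) :+ (β :+ β) :* (t₂ :+ i :* f)
         :- β :* β :* (s :+ i :* i)) refl

-- The coefficient 2β appears as β + β, so the ring identity behind the step needs no numeric
-- constant.
T₃-expansion : ∀ a b .{{_ : NonZero a}} h →
  T₃ a b h ≡ T₁ a b h + ((+ b / a) + (+ b / a)) * T₂ a b h - (+ b / a) ² * sumOfSquares h
T₃-expansion a b zero = expansion-zero (+ b / a)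
T₃-expansion a b (suc h) = begin
  T₃ a b (suc h)
    ≡⟨ ∑₁-suc h (λ i → ⌊q⌋ i ²) ⟩
  T₃ a b h + f ²
    ≡⟨ cong (_+ f ²) (T₃-expansion a b h) ⟩
  T₁ a b h + (β + β) * T₂ a b h - β ² * sumOfSquares h + f ²
    ≡⟨ expansion-step (T₁ a b h) (T₂ a b h) (sumOfSquares h) β (fromℕ (suc h)) f ⟩
  rhs (T₁ a b h + (fromℕ (suc h) * β - f) ²) (T₂ a b h + fromℕ (suc h) * f)
      (sumOfSquares h + fromℕ (suc h) ²)
    -- `frac (q (suc h))` unfolds to `q (suc h) - f`, and `q (suc h)` is (h+1)β.
    ≡⟨ cong (λ x → rhs (T₁ a b h + (x - f) ²) (T₂ a b h + fromℕ (suc h) * f)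
                       (sumOfSquares h + fromℕ (suc h) ²))
         (*-/-assoc (suc h) b a) ⟨
  rhs (T₁ a b h + frac (q (suc h)) ²) (T₂ a b h + fromℕ (suc h) * f)
      (sumOfSquares h + fromℕ (suc h) ²)
    ≡⟨ cong₂ (λ t₁ t₂ → rhs t₁ t₂ (sumOfSquares h + fromℕ (suc h) ²))
         (∑₁-suc h (λ i → frac (q i) ²)) (∑₁-suc h (λ i → fromℕ i * ⌊q⌋ i)) ⟨
  rhs (T₁ a b (suc h)) (T₂ a b (suc h)) (sumOfSquares h + fromℕ (suc h) ²)
    ≡⟨ cong (rhs (T₁ a b (suc h)) (T₂ a b (suc h))) (sumOfSquares-suc h) ⟨
  rhs (T₁ a b (suc h)) (T₂ a b (suc h)) (sumOfSquares (suc h)) ∎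
  where
  q ⌊q⌋ : ℕ → ℚ
  q i = + (i ℕ.* b) / a
  ⌊q⌋ i = fromℤ (floor (q i))

  β = + b / a
  f = ⌊q⌋ (suc h)

  rhs : ℚ → ℚ → ℚ → ℚ
  rhs t₁ t₂ s = t₁ + (β + β) * t₂ - β ² * s

mainTheorem3 : (a b : ℕ) .{{_ : NonZero a}} .{{_ : NonZero b}} → Coprime a b → (h : ℕ) →
    T₃ a b h ≡
    T₁ a b h + (+ (2 ℕ.* b) / a) * T₂ a b h
    - (+ (b ℕ.^ 2 ℕ.* h ℕ.* (h ℕ.+ 1) ℕ.* (2 ℕ.* h ℕ.+ 1)) / (6 ℕ.* a ℕ.^ 2))
mainTheorem3 a b _ h = trans (T₃-expansion a b h)
  (sym (cong₂ (λ c r → T₁ a b h + c * T₂ a b h - r) (twice-/ b a) (closedForm a b h)))
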